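{- For every tree $T$ and for every integer $k\ge 1$, $$\gamma_{1k}(T)\le \gamma(T)+\left\lceil \frac{\gamma(T)}{k}\right\rceil-1,$$ and this bound is tight.
   Context: All graphs are finite, undirected, simple and connected; a tree is a connected acyclic graph. A set $S$ of vertices of a graph $G$ is a dominating set if every vertex not in $S$ is adjacent to at least one vertex of $S$; the domination number $\gamma(G)$ is the minimum cardinality of a dominating set. For an integer $k\ge 1$, a $k$-quasiperfect dominating set of $G$ is a dominating set $S$ such that every vertex not in $S$ is adjacent to at most $k$ vertices of $S$; $\gamma_{1k}(G)$ is the minimum cardinality of such a set. -}

module Defs where

open import Data.Empty using (⊥-elim)
open import Data.Fin.Base using (Fin)
open import Data.Fin.Properties using (all?; any?)
open import Data.Fin.Subset using (Subset; _∈_; _∉_; _∩_; ∣_∣; ⊤)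
open import Data.Fin.Subset.Properties using (_∈?_; anySubset?; ∈⊤)
open import Data.Integer.Base as ℤ using (ℤ; +_; 1ℤ)
open import Data.List.Base using (List; _∷_; _∷ʳ_; length)
open import Data.List.Relation.Unary.Linked using (Linked)
open import Data.List.Relation.Unary.Unique.Propositional using (Unique)
open import Data.Nat.Base as ℕ using (ℕ; NonZero)
open import Data.Nat.Induction using (Acc; acc; <-wellFounded)
open import Data.Nat.Properties using (_≤?_; _<?_; ≮⇒≥)
open import Data.Product.Base using (∃; _×_; _,_; proj₁; proj₂)
open import Data.Rational.Unnormalised.Base using (_/_; ceiling)
open import Data.Vec.Base using (tabulate)
open import Level using (0ℓ)
open import Relation.Binary.Construct.Closure.ReflexiveTransitive using (Star)
open import Relation.Binary.Core using (Rel)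
open import Relation.Binary.Definitions using (Decidable; Symmetric; Irreflexive)
open import Relation.Binary.PropositionalEquality.Core using (_≡_; refl)
open import Relation.Nullary.Decidable.Core using (yes; no; does; ¬?; _×-dec_; _→-dec_)
open import Relation.Nullary.Negation.Core using (¬_)
import Relation.Unary as U

-- Finite simple graphs with vertex set Fin n.  Adjacency is required to be
-- decidable, which classically is no restriction; it is what makes the
-- minima below computable.
record Graph (n : ℕ) : Set₁ where
  field
    Adj    : Rel (Fin n) 0ℓ
    adj?   : Decidable Adj
    sym    : Symmetric Adj
    irrefl : Irreflexive _≡_ Adj

  neighbours : Fin n → Subset n
  neighbours v = tabulate (λ u → does (adj? v u))

open Graph public using (neighbours)

Connected : ∀ {n} → Graph n → Set
Connected G = ∀ u v → Star (Graph.Adj G) u v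

-- The cycle v, w₁, …, wₗ, v; it has l + 1 vertices, so l ≥ 2.
record IsCycle {n} (G : Graph n) (v : Fin n) (ws : List (Fin n)) : Set where
  field
    distinct : Unique (v ∷ ws)
    closed   : Linked (Graph.Adj G) (v ∷ (ws ∷ʳ v))
    long     : 2 ℕ.≤ length ws

Acyclic : ∀ {n} → Graph n → Set
Acyclic G = ∀ v ws → ¬ IsCycle G v ws

record IsTree {n} (G : Graph n) : Set where
  field
    nonempty  : NonZero n
    connected : Connected G
    acyclic   : Acyclic G

IsDominating : ∀ {n} → Graph n → Subset n → Set
IsDominating G S = ∀ v → v ∉ S → ∃ λ u → u ∈ S × Graph.Adj G v u

IsQuasiperfect : ∀ {n} → ℕ → Graph n → Subset n → Set
IsQuasiperfect k G S =
  IsDominating G S × (∀ v → v ∉ S → ∣ neighbours G v ∩ S ∣ ℕ.≤ k)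

IsMinimumCardinality : ∀ {n} → (Subset n → Set) → ℕ → Set
IsMinimumCardinality P m =
  (∃ λ S → P S × ∣ S ∣ ≡ m) × (∀ S → P S → m ℕ.≤ ∣ S ∣)

minimumCardinality : ∀ {n} {P : Subset n → Set} → U.Decidable P → ∃ P →
                     ∃ (IsMinimumCardinality P)
minimumCardinality {P = P} P? (S , PS) = go S PS (<-wellFounded ∣ S ∣)
  where
  go : ∀ S → P S → Acc ℕ._<_ ∣ S ∣ → ∃ (IsMinimumCardinality P)
  go S PS (acc rec) with anySubset? (λ S′ → P? S′ ×-dec (∣ S′ ∣ <? ∣ S ∣))
  ... | yes (S′ , PS′ , smaller) = go S′ PS′ (rec smaller)
  ... | no  none =
    ∣ S ∣ , (S , PS , refl) , λ S′ PS′ → ≮⇒≥ (λ smaller → none (S′ , PS′ , smaller))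

isDominating? : ∀ {n} (G : Graph n) → U.Decidable (IsDominating G)
isDominating? G S =
  all? (λ v → ¬? (v ∈? S) →-dec any? (λ u → (u ∈? S) ×-dec Graph.adj? G v u))

isQuasiperfect? : ∀ {n} k (G : Graph n) → U.Decidable (IsQuasiperfect k G)
isQuasiperfect? k G S =
  isDominating? G S ×-dec
  all? (λ v → ¬? (v ∈? S) →-dec (∣ neighbours G v ∩ S ∣ ≤? k))

⊤-isQuasiperfect : ∀ {n} k (G : Graph n) → IsQuasiperfect k G ⊤
⊤-isQuasiperfect k G = (λ v v∉⊤ → ⊥-elim (v∉⊤ ∈⊤)) , (λ v v∉⊤ → ⊥-elim (v∉⊤ ∈⊤))

γ-minimum : ∀ {n} (G : Graph n) → ∃ (IsMinimumCardinality (IsDominating G))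
γ-minimum G = minimumCardinality (isDominating? G) (⊤ , proj₁ (⊤-isQuasiperfect 0 G))

γ₁-minimum : ∀ {n} k (G : Graph n) → ∃ (IsMinimumCardinality (IsQuasiperfect k G))
γ₁-minimum k G = minimumCardinality (isQuasiperfect? k G) (⊤ , ⊤-isQuasiperfect k G)

γ : ∀ {n} → Graph n → ℕ
γ G = proj₁ (γ-minimum G)

γ₁ : ∀ {n} → ℕ → Graph n → ℕ
γ₁ k G = proj₁ (γ₁-minimum k G)

bound : (k : ℕ) .{{_ : NonZero k}} → ℕ → ℤ
bound k g = + g ℤ.+ ceiling (+ g / k) ℤ.- 1ℤ

{-# OPTIONS --safe #-}
module Submission where

-- Upper bound: starting from a minimum dominating set of size γ, keep adding a
-- vertex with more than k neighbours in the current set.  Each of the r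
-- additions creates at least k + 1 edges inside the set, and the resulting
-- γ + r vertices span a forest, so r (k + 1) ≤ γ + r − 1, that is k r ≤ γ − 1.
--
-- Tightness: write g − 1 = r k + t with t < k.  Take g centres, each with k + 1
-- pendant leaves, and r connectors, each adjacent to the root centre and to k
-- private centres; the t remaining centres hang from the root.  A centre
-- outside a k-quasiperfect set would need all its k + 1 leaves in the set, so
-- all centres, and then all connectors, belong to it, and γ₁ₖ ≥ g + r.  As the
-- centres dominate, γ ≤ g, and the upper bound leaves no room for γ < g.

open import Defs
open import Data.Integer.Base using (+_; _≤_)
open import Data.Nat.Base using (ℕ; NonZero)
open import Data.Product.Base using (∃; _×_)
open import Relation.Binary.PropositionalEquality.Core using (_≡_)

open import Data.Bool.Base using (Bool; true; false; _∧_; if_then_else_)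
open import Data.Empty using (⊥; ⊥-elim)
open import Data.Fin.Base using (Fin; zero; suc; _↑ʳ_; splitAt; quotient; combine)
open import Data.Fin.Properties
  using (_≟_; any?; injective⇒≤; suc-injective; +↔⊎; *↔×; splitAt-↑ʳ; remQuot-combine
        ; combine-injectiveʳ; ↑ʳ-injective)
open import Data.Fin.Subset as Subset
  using (Subset; inside; outside; _∈_; _∉_; _∩_; _-_; ∣_∣; ⁅_⁆; Nonempty)
open import Data.Fin.Subset.Properties
  using (_∈?_; ∣p∣≤n; ∣⊥∣≡0; Empty-unique; nonempty?; p⊆q⇒∣p∣≤∣q∣; ∣⁅x⁆∣≡1; x∈⁅x⁆; x∈p∩q⁻
        ; x∈p∩q⁺; ∣p∩q∣≤∣q∣; x∈p⇒∣p-x∣<∣p∣; x∈p∧x≢y⇒x∈p-y)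
open import Data.Integer.Base as ℤ using (-[1+_]; 1ℤ; +≤+)
import Data.Integer.DivMod as ℤ
import Data.Integer.Properties as ℤ
open import Data.List.Base using (List; []; _∷_; _++_; _∷ʳ_; length; lookup)
import Data.List.Membership.Propositional as List
open import Data.List.Membership.Propositional.Properties using (∈-∃++; ∈-lookup)
open import Data.List.Properties using (++-assoc; length-++)
open import Data.List.Relation.Unary.All as All using (All; []; _∷_)
open import Data.List.Relation.Unary.All.Properties using (++⁻ˡ; ¬Any⇒All¬)
open import Data.List.Relation.Unary.AllPairs using ([]; _∷_)
open import Data.List.Relation.Unary.Any using (here; there)
open import Data.List.Relation.Unary.Linked using (Linked; [-]; _∷_)
open import Data.List.Relation.Unary.Unique.Propositional using (Unique)
open import Data.Nat.Base as ℕ using (zero; suc; pred; _+_; _*_; _/_; _%_; z≤n; s≤s)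
open import Data.Nat.Divisibility using (divides-refl)
import Data.Nat.DivMod as ℕ
open import Data.Nat.Induction using (Acc; acc; <-wellFounded)
import Data.Nat.Properties as ℕ
open import Algebra.Properties.Semiring.Sum ℕ.+-*-semiring
  using (sum-syntax; sum-cong-≗; sum-replicate-zero; ∑-distrib-+)
open import Data.Nat.Solver using (module +-*-Solver)
open import Data.Product.Base using (∃₂; _,_; proj₁; proj₂)
open import Data.Sum.Base using (_⊎_; inj₁; inj₂; [_,_]′)
open import Data.Sum.Function.Propositional using (_⊎-↔_)
open import Data.Sum.Properties using (inj₁-injective)
open import Data.Vec.Base as Vec using (_[_]≔_; []; _∷_)
open import Data.Vec.Properties
  using ([]=⇒lookup; lookup⇒[]=; lookup-zipWith; lookup∘tabulate; lookup∘update; lookup∘update′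
        ; []≔-idempotent; []≔-lookup; []≔-updates; []≔-minimal)
open import Function.Base using (_∘_; _$_; const)
open import Function.Bundles using (_↔_; module Inverse; module Injection)
open import Function.Construct.Composition using (_↔-∘_)
open import Function.Properties.Inverse using (↔⇒↣; ↔-sym)
open import Relation.Binary.Construct.Closure.ReflexiveTransitive using (Star; ε; _◅_; _◅◅_; reverse)
open import Relation.Binary.PropositionalEquality
  using (_≢_; refl; sym; trans; cong; cong₂; subst; subst₂; module ≡-Reasoning)
open import Relation.Nullary using (¬_; Dec; yes; no; does; contradiction)
open import Relation.Nullary.Decidable using (¬?; _×-dec_; _⊎-dec_; dec-true; dec-false)

-- Finite subsets: insertion, deletion and cardinality.

∈⁺ : ∀ {n} {S : Subset n} {v} → Vec.lookup S v ≡ inside → v ∈ S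
∈⁺ {S = S} {v} = lookup⇒[]= v S

∉⇒outside : ∀ {n} {S : Subset n} {v} → v ∉ S → Vec.lookup S v ≡ outside
∉⇒outside {S = S} {v} v∉S with Vec.lookup S v in eq
... | true  = contradiction (∈⁺ eq) v∉S
... | false = refl

∣insert∣ : ∀ {n} (S : Subset n) v → Vec.lookup S v ≡ outside →
           ∣ S [ v ]≔ inside ∣ ≡ suc ∣ S ∣
∣insert∣ (false ∷ S) zero    refl = refl
∣insert∣ (true  ∷ S) (suc v) v∉S  = cong suc (∣insert∣ S v v∉S)
∣insert∣ (false ∷ S) (suc v) v∉S  = ∣insert∣ S v v∉S

∣S∣≡0⇒outside : ∀ {n} (S : Subset n) → ∣ S ∣ ≡ 0 → ∀ v → Vec.lookup S v ≡ outside
∣S∣≡0⇒outside S eq v = ∉⇒outside {S = S} λ v∈S →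
  ℕ.n≮0 (subst (∣ S - v ∣ ℕ.<_) eq (x∈p⇒∣p-x∣<∣p∣ {p = S} v∈S))

delete⊆ : ∀ {n} (S : Subset n) v {w} → w ∈ S [ v ]≔ outside → w ∈ S
delete⊆ S v {w} w∈ with w ≟ v
... | yes refl = contradiction (trans (sym ([]=⇒lookup w∈)) (lookup∘update v S outside)) λ ()
... | no  w≢v  = ∈⁺ (trans (sym (lookup∘update′ w≢v S outside)) ([]=⇒lookup w∈))

insert⊇ : ∀ {n} (S : Subset n) v {w} → w ∈ S → w ∈ S [ v ]≔ inside
insert⊇ S v {w} w∈S with w ≟ v
... | yes refl = []≔-updates S v
... | no  w≢v  = []≔-minimal S w v w≢v w∈S

∈⇒0<∣S∣ : ∀ {n} (S : Subset n) {v} → v ∈ S → 0 ℕ.< ∣ S ∣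
∈⇒0<∣S∣ S v∈S = ℕ.≤-<-trans z≤n (x∈p⇒∣p-x∣<∣p∣ {p = S} v∈S)

0<∣S∣⇒Nonempty : ∀ {n} (S : Subset n) → 0 ℕ.< ∣ S ∣ → Nonempty S
0<∣S∣⇒Nonempty {n} S 0<∣S∣ with nonempty? S
... | yes ne = ne
... | no  e  = contradiction (subst (0 ℕ.<_) (trans (cong ∣_∣ (Empty-unique e)) (∣⊥∣≡0 n)) 0<∣S∣) ℕ.n≮0

injective⇒≤∣S∣ : ∀ {m n} {S : Subset n} (f : Fin m → Fin n) →
                 (∀ {i j} → f i ≡ f j → i ≡ j) → (∀ i → f i ∈ S) → m ℕ.≤ ∣ S ∣
injective⇒≤∣S∣ {zero}  f f-inj f∈S = z≤n
injective⇒≤∣S∣ {suc m} {S = S} f f-inj f∈S = ℕ.≤-<-trans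
  (injective⇒≤∣S∣ {S = S - f zero} (f ∘ suc) (suc-injective ∘ f-inj)
    (λ i → x∈p∧x≢y⇒x∈p-y (f∈S (suc i)) (λ eq → 1+i≢0 (f-inj eq))))
  (x∈p⇒∣p-x∣<∣p∣ {p = S} (f∈S zero))
  where
  1+i≢0 : ∀ {i : Fin m} → suc i ≢ zero
  1+i≢0 ()

-- For leaving a vertex of a path without stepping back to its predecessor `p`: otherwise `S` would
-- lie inside a singleton.
1<∣S∣⇒other : ∀ {n} (S : Subset n) → 1 ℕ.< ∣ S ∣ → ∀ p → ∃ λ v → v ∈ S × v ≢ p
1<∣S∣⇒other S 1<∣S∣ p with any? (λ v → (v ∈? S) ×-dec ¬? (v ≟ p))
... | yes found = found
... | no  none  = contradiction (subst (∣ S ∣ ℕ.≤_) (∣⁅x⁆∣≡1 p) (p⊆q⇒∣p∣≤∣q∣ S⊆⁅p⁆)) (ℕ.<⇒≱ 1<∣S∣)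
  where
  S⊆⁅p⁆ : ∀ {v} → v ∈ S → v ∈ ⁅ p ⁆
  S⊆⁅p⁆ {v} v∈S with v ≟ p
  ... | yes refl = x∈⁅x⁆ p
  ... | no  v≢p  = contradiction (v , v∈S , v≢p) none

-- Counting the edges inside a vertex set by indicator sums.

⟦_⟧ : Bool → ℕ
⟦ b ⟧ = if b then 1 else 0

δ : ∀ {n} → Fin n → Fin n → ℕ
δ v w = ⟦ does (v ≟ w) ⟧

χ : ∀ {n} → Subset n → Fin n → ℕ
χ S v = ⟦ Vec.lookup S v ⟧

∑-δ : ∀ {n} (v : Fin n) (f : Fin n → ℕ) → ∑[ w < n ] (δ v w * f w) ≡ f v
∑-δ {suc n} zero    f = begin
  f zero + 0 + ∑[ w < n ] 0  ≡⟨ cong₂ _+_ (ℕ.+-identityʳ (f zero)) (sum-replicate-zero n) ⟩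
  f zero + 0                 ≡⟨ ℕ.+-identityʳ (f zero) ⟩
  f zero                     ∎
  where open ≡-Reasoning
∑-δ {suc n} (suc v) f = ∑-δ v (f ∘ suc)

∣S∣≡∑χ : ∀ {n} (S : Subset n) → ∣ S ∣ ≡ ∑[ v < n ] χ S v
∣S∣≡∑χ []          = refl
∣S∣≡∑χ (true  ∷ S) = cong suc (∣S∣≡∑χ S)
∣S∣≡∑χ (false ∷ S) = ∣S∣≡∑χ S

χ-insert : ∀ {n} (S : Subset n) v → Vec.lookup S v ≡ outside →
           ∀ w → χ (S [ v ]≔ inside) w ≡ δ v w + χ S w
χ-insert S v v∉S w with v ≟ w
... | yes refl rewrite lookup∘update v S inside | v∉S = refl
... | no  v≢w  = cong ⟦_⟧ (lookup∘update′ (v≢w ∘ sym) S inside)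

module _ {n} (G : Graph n) where
  open Graph G using (Adj; adj?)

  adj : Fin n → Fin n → ℕ
  adj u v = ⟦ does (adj? u v) ⟧

  adj-sym : ∀ u v → adj u v ≡ adj v u
  adj-sym u v with adj? u v
  ... | yes u~v rewrite dec-true (adj? v u) (Graph.sym G u~v) = refl
  ... | no  u≁v rewrite dec-false (adj? v u) (u≁v ∘ Graph.sym G) = refl

  adj-irrefl : ∀ v → adj v v ≡ 0
  adj-irrefl v rewrite dec-false (adj? v v) (Graph.irrefl G refl) = refl

  ∈-neighbours⁻ : ∀ {u v} → u ∈ neighbours G v → Adj v u
  ∈-neighbours⁻ {u} {v} u∈N
    with adj? v u | trans (sym (lookup∘tabulate (λ w → does (adj? v w)) u)) ([]=⇒lookup u∈N)
  ... | yes v~u | _  = v~u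
  ... | no  _   | ()

  ∈-neighbours⁺ : ∀ {u v} → Adj v u → u ∈ neighbours G v
  ∈-neighbours⁺ {u} {v} v~u =
    ∈⁺ (trans (lookup∘tabulate (λ w → does (adj? v w)) u) (dec-true (adj? v u) v~u))

  degree : (Fin n → ℕ) → Fin n → ℕ
  degree s v = ∑[ w < n ] (s w * adj v w)

  pairs : (Fin n → ℕ) → ℕ
  pairs s = ∑[ v < n ] (s v * degree s v)

  -- Every edge inside S is counted in both directions.
  arcs : Subset n → ℕ
  arcs S = pairs (χ S)

  ∣N∩S∣≡degree : ∀ v S → ∣ neighbours G v ∩ S ∣ ≡ degree (χ S) v
  ∣N∩S∣≡degree v S = trans (∣S∣≡∑χ (neighbours G v ∩ S)) (sum-cong-≗ pointwise)
    where
    pointwise : ∀ w → χ (neighbours G v ∩ S) w ≡ χ S w * adj v w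
    pointwise w
      rewrite lookup-zipWith _∧_ w (neighbours G v) S
            | lookup∘tabulate (λ u → does (adj? v u)) w
      with does (adj? v w) | Vec.lookup S w
    ... | true  | true  = refl
    ... | true  | false = refl
    ... | false | true  = refl
    ... | false | false = refl

  -- Weights replace subsets here, so that inserting `v` becomes adding `δ v` and the sums are
  -- linear in the weight.
  degree-+δ : ∀ {s s′ v} → (∀ w → s′ w ≡ δ v w + s w) →
              ∀ u → degree s′ u ≡ adj u v + degree s u
  degree-+δ {s} {s′} {v} s′≗ u = begin
    ∑[ w < n ] (s′ w * adj u w)
      ≡⟨ sum-cong-≗ (λ w → trans (cong (_* adj u w) (s′≗ w))
                                 (ℕ.*-distribʳ-+ (adj u w) (δ v w) (s w))) ⟩
    ∑[ w < n ] (δ v w * adj u w + s w * adj u w)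
      ≡⟨ ∑-distrib-+ (λ w → δ v w * adj u w) (λ w → s w * adj u w) ⟩
    ∑[ w < n ] (δ v w * adj u w) + degree s u
      ≡⟨ cong (_+ degree s u) (∑-δ v (adj u)) ⟩
    adj u v + degree s u ∎
    where open ≡-Reasoning

  -- `pairs` is the quadratic form of the adjacency matrix. Expanding it at `δ v + s`, the two cross
  -- terms agree by symmetry and the term `adj v v` vanishes.
  pairs-+δ : ∀ {s s′ v} → (∀ w → s′ w ≡ δ v w + s w) →
             pairs s′ ≡ pairs s + 2 * degree s v
  pairs-+δ {s} {s′} {v} s′≗ = begin
    ∑[ u < n ] (s′ u * degree s′ u)
      ≡⟨ sum-cong-≗ (λ u → trans (cong (_* degree s′ u) (s′≗ u))
                                 (ℕ.*-distribʳ-+ (degree s′ u) (δ v u) (s u))) ⟩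
    ∑[ u < n ] (δ v u * degree s′ u + s u * degree s′ u)
      ≡⟨ ∑-distrib-+ (λ u → δ v u * degree s′ u) (λ u → s u * degree s′ u) ⟩
    ∑[ u < n ] (δ v u * degree s′ u) + ∑[ u < n ] (s u * degree s′ u)
      ≡⟨ cong₂ _+_ (trans (∑-δ v (degree s′)) (degree-+δ {s} {s′} {v} s′≗ v)) (sum-cong-≗ expand) ⟩
    (adj v v + degree s v) + ∑[ u < n ] (s u * adj v u + s u * degree s u)
      ≡⟨ cong₂ _+_ (cong (_+ degree s v) (adj-irrefl v))
                   (∑-distrib-+ (λ u → s u * adj v u) (λ u → s u * degree s u)) ⟩
    degree s v + (degree s v + pairs s)
      ≡⟨ solve 2 (λ d p → d :+ (d :+ p) := p :+ con 2 :* d) refl (degree s v) (pairs s) ⟩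
    pairs s + 2 * degree s v ∎
    where
    open ≡-Reasoning
    open +-*-Solver
    expand : ∀ u → s u * degree s′ u ≡ s u * adj v u + s u * degree s u
    expand u = trans (cong (s u *_) (trans (degree-+δ {s} {s′} {v} s′≗ u)
                                           (cong (_+ degree s u) (adj-sym u v))))
                     (ℕ.*-distribˡ-+ (s u) (adj v u) (degree s u))

  arcs-insert : ∀ S v → Vec.lookup S v ≡ outside →
             arcs (S [ v ]≔ inside) ≡ arcs S + 2 * ∣ neighbours G v ∩ S ∣
  arcs-insert S v v∉S = trans (pairs-+δ {s = χ S} {v = v} (χ-insert S v v∉S))
                           (cong (λ d → arcs S + 2 * d) (sym (∣N∩S∣≡degree v S)))

  arcs-empty : ∀ S → ∣ S ∣ ≡ 0 → arcs S ≡ 0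
  arcs-empty S ∣S∣≡0 = trans
    (sum-cong-≗ λ v → cong (λ b → ⟦ b ⟧ * degree (χ S) v) (∣S∣≡0⇒outside S ∣S∣≡0 v))
    (sum-replicate-zero n)

-- Forests: existence of leaves and the bound on edges.

Linked-close : ∀ {A : Set} {R : A → A → Set} {x y z} xs {ys} →
               Linked R (x ∷ xs ++ y ∷ ys) → R y z → Linked R (x ∷ (xs ∷ʳ y) ∷ʳ z)
Linked-close []       (r ∷ _) yz = r ∷ yz ∷ [-]
Linked-close (_ ∷ xs) (r ∷ l) yz = r ∷ Linked-close xs l yz

Unique-++⁻ˡ : ∀ {A : Set} (xs : List A) {ys} → Unique (xs ++ ys) → Unique xs
Unique-++⁻ˡ []       _         = []
Unique-++⁻ˡ (x ∷ xs) (x∉ ∷ u) = ++⁻ˡ xs x∉ ∷ Unique-++⁻ˡ xs u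

Unique⇒length≤n : ∀ {n} {xs : List (Fin n)} → Unique xs → length xs ℕ.≤ n
Unique⇒length≤n u = injective⇒≤ (lookup-injective u)
  where
  lookup-injective : ∀ {A : Set} {xs : List A} → Unique xs →
                     ∀ {i j} → lookup xs i ≡ lookup xs j → i ≡ j
  lookup-injective (_  ∷ _) {zero}  {zero}  eq = refl
  lookup-injective (x∉ ∷ _) {zero}  {suc j} eq = contradiction eq (All.lookup x∉ (∈-lookup j))
  lookup-injective (x∉ ∷ _) {suc i} {zero}  eq = contradiction (sym eq) (All.lookup x∉ (∈-lookup i))
  lookup-injective (_  ∷ u) {suc i} {suc j} eq = cong suc (lookup-injective u eq)

module _ {n} (G : Graph n) (acyclic : Acyclic G) where
  open Graph G using (Adj)

  -- A neighbour of the head `x` lying beyond the second vertex `p` cuts off an initial segment of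
  -- the path, and the edge back to `x` closes it to a cycle.
  no-chord : ∀ {x p ps y} → Unique (x ∷ p ∷ ps) → Linked Adj (x ∷ p ∷ ps) →
             Adj x y → y List.∈ ps → ⊥
  no-chord {x} {p} {ps} {y} u l x~y y∈ps with as , bs , refl ← ∈-∃++ y∈ps =
    acyclic x (p ∷ (as ∷ʳ y)) record
      { distinct = Unique-++⁻ˡ (x ∷ p ∷ (as ∷ʳ y))
                     (subst (λ zs → Unique (x ∷ p ∷ zs)) (sym (++-assoc as (y ∷ []) bs)) u)
      ; closed   = Linked-close (p ∷ as) l (Graph.sym G x~y)
      ; long     = s≤s (subst (1 ℕ.≤_) (sym (length-++ as)) (ℕ.m≤n+m 1 (length as)))
      }

  module _ (S : Subset n) (two : ∀ v → v ∈ S → 1 ℕ.< ∣ neighbours G v ∩ S ∣) where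

    -- The path grows at its head `x`. Having two neighbours in `S`, `x` has one other than its
    -- predecessor `p`, and `no-chord` keeps that one off the rest of the path. When `fuel` runs
    -- out, the path has more than `n` distinct vertices.
    no-path : ∀ fuel {x xs} → Unique (x ∷ xs) → Linked Adj (x ∷ xs) → x ∈ S →
              n ℕ.< fuel + length (x ∷ xs) → ⊥
    continue : ∀ fuel {x xs y} → Unique (x ∷ xs) → Linked Adj (x ∷ xs) → y ∈ neighbours G x ∩ S →
               ¬ (y List.∈ xs) → n ℕ.< suc fuel + length (x ∷ xs) → ⊥

    no-path zero u _ _ n< = ℕ.<⇒≱ n< (Unique⇒length≤n u)
    no-path (suc fuel) {x} {[]} u l x∈S n<
      with y , y∈N∩S , _ ← 1<∣S∣⇒other _ (two x x∈S) x = continue fuel u l y∈N∩S (λ ()) n<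
    no-path (suc fuel) {x} {p ∷ ps} u l x∈S n<
      with y , y∈N∩S , y≢p ← 1<∣S∣⇒other _ (two x x∈S) p = continue fuel u l y∈N∩S y∉ n<
      where
      y∉ : ¬ (y List.∈ p ∷ ps)
      y∉ (here y≡p)   = y≢p y≡p
      y∉ (there y∈ps) = no-chord u l (∈-neighbours⁻ G (proj₁ (x∈p∩q⁻ _ S y∈N∩S))) y∈ps

    continue fuel {x} {xs} {y} u l y∈N∩S y∉xs n<
      with y∈N , y∈S ← x∈p∩q⁻ (neighbours G x) S y∈N∩S =
      no-path fuel (¬Any⇒All¬ _ y∉ ∷ u) (Graph.sym G x~y ∷ l) y∈S
        (subst (n ℕ.<_) (sym (ℕ.+-suc fuel _)) n<)
      where
      x~y : Adj x y
      x~y = ∈-neighbours⁻ G y∈N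
      y∉ : ¬ (y List.∈ x ∷ xs)
      y∉ (here y≡x)   = Graph.irrefl G (sym y≡x) x~y
      y∉ (there y∈xs) = y∉xs y∈xs

  exists-leaf : ∀ S → Nonempty S → ∃ λ v → v ∈ S × ∣ neighbours G v ∩ S ∣ ℕ.≤ 1
  exists-leaf S (x , x∈S) with any? (λ v → (v ∈? S) ×-dec (∣ neighbours G v ∩ S ∣ ℕ.≤? 1))
  ... | yes leaf = leaf
  -- The path starts as the single vertex `x`, so fuel `n` already gives `n < n + 1`.
  ... | no  none = ⊥-elim $ no-path S (λ v v∈S → ℕ.≰⇒> λ le → none (v , v∈S , le))
                     n ([] ∷ []) [-] x∈S (ℕ.≤-reflexive (ℕ.+-comm 1 n))

  -- Induction on the size: deleting a leaf of the induced subgraph removes at most one edge, hence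
  -- two arcs. With `pred` the empty set is covered too.
  forest-bound : ∀ m S → ∣ S ∣ ≡ m → arcs G S ℕ.≤ 2 * pred m
  forest-bound zero    S ∣S∣≡0 = ℕ.≤-reflexive (arcs-empty G S ∣S∣≡0)
  forest-bound (suc m) S ∣S∣≡1+m
    with v , v∈S , leaf ← exists-leaf S
           (0<∣S∣⇒Nonempty S (subst (0 ℕ.<_) (sym ∣S∣≡1+m) (s≤s z≤n))) = begin
    arcs G S
      ≡⟨ cong (arcs G) insert ⟨
    arcs G (S′ [ v ]≔ inside)
      ≡⟨ arcs-insert G S′ v v∉S′ ⟩
    arcs G S′ + 2 * ∣ neighbours G v ∩ S′ ∣
      ≤⟨ ℕ.+-mono-≤ (forest-bound m S′ ∣S′∣≡m) (ℕ.*-monoʳ-≤ 2 d≤) ⟩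
    -- The minimum records that the last remaining vertex (`m = 0`) has no edge to lose; this is
    -- where a nonempty forest gains its one edge fewer than vertices.
    2 * pred m + 2 * (1 ℕ.⊓ m)
      ≡⟨ ℕ.*-distribˡ-+ 2 (pred m) (1 ℕ.⊓ m) ⟨
    2 * (pred m + 1 ℕ.⊓ m)
      ≡⟨ cong (2 *_) (pred+ m) ⟩
    2 * m ∎
    where
    open ℕ.≤-Reasoning
    S′ : Subset n
    S′ = S [ v ]≔ outside
    v∉S′ : Vec.lookup S′ v ≡ outside
    v∉S′ = lookup∘update v S outside
    insert : S′ [ v ]≔ inside ≡ S
    insert = trans ([]≔-idempotent S v)
                   (trans (cong (S [ v ]≔_) (sym ([]=⇒lookup v∈S))) ([]≔-lookup S v))
    ∣S′∣≡m : ∣ S′ ∣ ≡ m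
    ∣S′∣≡m = ℕ.suc-injective (trans (sym (∣insert∣ S′ v v∉S′)) (trans (cong ∣_∣ insert) ∣S∣≡1+m))
    N∩S′⊆N∩S : ∀ {w} → w ∈ neighbours G v ∩ S′ → w ∈ neighbours G v ∩ S
    N∩S′⊆N∩S w∈N∩S′ with w∈N , w∈S′ ← x∈p∩q⁻ (neighbours G v) S′ w∈N∩S′ =
      x∈p∩q⁺ (w∈N , delete⊆ S v w∈S′)
    d≤ : ∣ neighbours G v ∩ S′ ∣ ℕ.≤ 1 ℕ.⊓ m
    d≤ = ℕ.⊓-glb (ℕ.≤-trans (p⊆q⇒∣p∣≤∣q∣ N∩S′⊆N∩S) leaf)
                 (ℕ.≤-trans (∣p∩q∣≤∣q∣ (neighbours G v) S′) (ℕ.≤-reflexive ∣S′∣≡m))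
    pred+ : ∀ m → pred m + 1 ℕ.⊓ m ≡ m
    pred+ zero    = refl
    pred+ (suc m) = ℕ.+-comm m 1

-- The upper bound: saturating a dominating set.

dominating-insert : ∀ {n} (G : Graph n) S v → IsDominating G S → IsDominating G (S [ v ]≔ inside)
dominating-insert G S v dom w w∉ with u , u∈S , w~u ← dom w (w∉ ∘ insert⊇ S v) =
  u , insert⊇ S v u∈S , w~u

dominating⇒0<∣S∣ : ∀ {n} .{{_ : NonZero n}} (G : Graph n) S → IsDominating G S → 0 ℕ.< ∣ S ∣
dominating⇒0<∣S∣ {suc n} G S dom with zero ∈? S
... | yes 0∈S = ∈⇒0<∣S∣ S 0∈S
... | no  0∉S = ∈⇒0<∣S∣ S (proj₁ (proj₂ (dom zero 0∉S)))

module _ {n} (G : Graph n) (k : ℕ) where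
  private
    +∣insert∣ : ∀ m {S : Subset n} {v} → v ∉ S → m + ∣ S [ v ]≔ inside ∣ ≡ suc (m + ∣ S ∣)
    +∣insert∣ m {S} {v} v∉S =
      trans (cong (m ℕ.+_) (∣insert∣ S v (∉⇒outside v∉S))) (ℕ.+-suc m ∣ S ∣)

  -- If no outside vertex has more than `k` neighbours in `S`, then `S` is quasiperfect. Otherwise
  -- inserting such a vertex adds at least `2 * suc k` arcs and keeps domination. The set never
  -- exceeds `n` vertices, so the fuel suffices.
  saturate : ∀ fuel S → IsDominating G S → n ℕ.< fuel + ∣ S ∣ →
             ∃₂ λ S′ r → IsQuasiperfect k G S′ × ∣ S′ ∣ ≡ r + ∣ S ∣ ×
                         arcs G S + 2 * (r * suc k) ℕ.≤ arcs G S′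
  saturate zero       S dom n< = contradiction (∣p∣≤n S) (ℕ.<⇒≱ n<)
  saturate (suc fuel) S dom n<
    with any? (λ v → ¬? (v ∈? S) ×-dec (k ℕ.<? ∣ neighbours G v ∩ S ∣))
  ... | no none =
    S , 0 , (dom , λ v v∉S → ℕ.≮⇒≥ λ k< → none (v , v∉S , k<)) , refl
      , ℕ.≤-reflexive (ℕ.+-identityʳ (arcs G S))
  ... | yes (v , v∉S , k<)
    with S″ , r , quasi , ∣S″∣ , arcs≤ ← saturate fuel (S [ v ]≔ inside) (dominating-insert G S v dom)
           (subst (n ℕ.<_) (sym (+∣insert∣ fuel v∉S)) n<) =
    S″ , suc r , quasi , trans ∣S″∣ (+∣insert∣ r v∉S) , (begin
      arcs G S + 2 * (suc k + r * suc k)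
        ≡⟨ solve 3 (λ e a b → e :+ con 2 :* (a :+ b) := e :+ con 2 :* a :+ con 2 :* b)
             refl (arcs G S) (suc k) (r * suc k) ⟩
      arcs G S + 2 * suc k + 2 * (r * suc k)
        ≤⟨ ℕ.+-monoˡ-≤ (2 * (r * suc k)) (ℕ.+-monoʳ-≤ (arcs G S) (ℕ.*-monoʳ-≤ 2 k<)) ⟩
      arcs G S + 2 * ∣ neighbours G v ∩ S ∣ + 2 * (r * suc k)
        ≡⟨ cong (_+ 2 * (r * suc k)) (arcs-insert G S v (∉⇒outside v∉S)) ⟨
      arcs G (S [ v ]≔ inside) + 2 * (r * suc k)
        ≤⟨ arcs≤ ⟩
      arcs G S″ ∎)
    where
    open ℕ.≤-Reasoning
    open +-*-Solver

γ₁≤γ+r : ∀ {n} (T : Graph n) → IsTree T → ∀ k → ∃ λ r → γ₁ k T ℕ.≤ r + γ T × k * r ℕ.< γ T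
γ₁≤γ+r {n} T tree k
  with S , dom , ∣S∣≡γ ← proj₁ (proj₂ (γ-minimum T))
  with S′ , r , quasi , ∣S′∣ , arcs≤ ← saturate T k (suc n) S dom (ℕ.m≤m+n (suc n) ∣ S ∣) =
  r , subst (γ₁ k T ℕ.≤_) (trans ∣S′∣ (cong (r ℕ.+_) ∣S∣≡γ))
        (proj₂ (proj₂ (γ₁-minimum k T)) S′ quasi)
    , ℕ.+-cancelˡ-< r (k * r) (γ T) (begin-strict
        r + k * r
          ≡⟨ ℕ.*-comm (suc k) r ⟩
        r * suc k
          -- The arcs of the initial set are dropped, and the factor 2 from counting each edge in
          -- both directions cancels.
          ≤⟨ ℕ.*-cancelˡ-≤ 2 (ℕ.≤-trans (ℕ.m≤n+m _ (arcs T S))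
                               (ℕ.≤-trans arcs≤ (forest-bound T acyclic _ S′ refl))) ⟩
        pred ∣ S′ ∣
          <⟨ pred[n]<n (dominating⇒0<∣S∣ T S′ (proj₁ quasi)) ⟩
        ∣ S′ ∣
          ≡⟨ trans ∣S′∣ (cong (r ℕ.+_) ∣S∣≡γ) ⟩
        r + γ T ∎)
  where
  open ℕ.≤-Reasoning
  open IsTree tree
  instance
    n≢0 : NonZero n
    n≢0 = nonempty
  pred[n]<n : ∀ {m} → 0 ℕ.< m → pred m ℕ.< m
  pred[n]<n (s≤s _) = ℕ.≤-refl

-- Evaluating the ceiling in the bound.

suc-/-% : ∀ m d .{{_ : NonZero d}} →
          (suc m % d ≡ 0 × suc m / d ≡ suc (m / d)) ⊎
          (∃ λ s → suc m % d ≡ suc s × suc m / d ≡ m / d)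
suc-/-% m d with suc (m % d) ℕ.<? d
... | no  ≮d = inj₁
  ( trans (cong (_% d) eq) (ℕ.m*n%n≡0 (suc (m / d)) d)
  , trans (cong (_/ d) eq) (ℕ.m*n/n≡m (suc (m / d)) d))
  where
  eq : suc m ≡ suc (m / d) * d
  eq = trans (cong suc (ℕ.m≡m%n+[m/n]*n m d))
             (cong (_+ m / d * d) (ℕ.≤-antisym (ℕ.m%n<n m d) (ℕ.≮⇒≥ ≮d)))
... | yes <d = inj₂
  ( m % d
  , trans (cong (_% d) eq) (trans (ℕ.[m+kn]%n≡m%n (suc (m % d)) (m / d) d) (ℕ.m<n⇒m%n≡m <d))
  , trans (cong (_/ d) eq) (trans (ℕ.+-distrib-/-∣ʳ (suc (m % d)) (divides-refl (m / d)))
      (cong₂ _+_ (ℕ.m<n⇒m/n≡0 <d) (ℕ.m*n/n≡m (m / d) d))))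
  where
  eq : suc m ≡ suc (m % d) + m / d * d
  eq = cong suc (ℕ.m≡m%n+[m/n]*n m d)

-- Integer division of a negative number branches on whether the remainder of `suc m` is zero;
-- `suc-/-%` shows that both branches give the same floor.
-[1+]/ℕ : ∀ m d .{{_ : NonZero d}} → -[1+ m ] ℤ./ℕ d ≡ -[1+ m / d ]
-[1+]/ℕ m d with suc m % d | suc-/-% m d
... | zero  | inj₁ (_ , eq)     rewrite eq = refl
... | suc _ | inj₂ (_ , _ , eq) = cong -[1+_] eq
... | zero  | inj₂ (_ , () , _)
... | suc _ | inj₁ (() , _)

-- The ceiling of `(m + 1) / k` is the negated floor of the negated fraction, that is `m / k + 1`,
-- whose 1 cancels against the final subtraction. All later estimates can then stay in the natural
-- numbers.
bound-suc : ∀ k .{{_ : NonZero k}} m → bound k (suc m) ≡ + (suc m + m / k)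
bound-suc (suc k) m = begin
  + suc m ℤ.+ (ℤ.- (-[1+ m ] ℤ./ + suc k)) ℤ.- 1ℤ
    ≡⟨ cong (λ q → + suc m ℤ.+ (ℤ.- q) ℤ.- 1ℤ)
         (trans (ℤ.div-pos-is-/ℕ -[1+ m ] (suc k)) (-[1+]/ℕ m (suc k))) ⟩
  + (suc m + suc (m / suc k)) ℤ.- 1ℤ
    ≡⟨ cong (λ q → + q ℤ.- 1ℤ) (ℕ.+-suc (suc m) (m / suc k)) ⟩
  + (suc m + m / suc k) ∎
  where open ≡-Reasoning

-- Trees given by a parent map and a depth function.

module RootedTree {n} (parent : Fin n → Fin n) (depth : Fin n → ℕ) (root : Fin n)
                  (descends : ∀ v → v ≡ root ⊎ depth (parent v) ℕ.< depth v) where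

  -- The depth condition discards the arbitrary value `parent root`: every vertex descends to the
  -- root, so none is shallower than it.
  Child : Fin n → Fin n → Set
  Child u v = parent u ≡ v × depth v ℕ.< depth u

  graph : Graph n
  graph = record
    { Adj    = λ u v → Child u v ⊎ Child v u
    ; adj?   = λ u v → child? u v ⊎-dec child? v u
    ; sym    = λ { (inj₁ c) → inj₂ c ; (inj₂ c) → inj₁ c }
    ; irrefl = λ { refl (inj₁ (_ , lt)) → ℕ.<-irrefl refl lt
                 ; refl (inj₂ (_ , lt)) → ℕ.<-irrefl refl lt }
    }
    where
    child? : ∀ u v → Dec (Child u v)
    child? u v = (parent u ≟ v) ×-dec (depth v ℕ.<? depth u)

  open Graph graph using (Adj)

  to-root : ∀ v → Acc ℕ._<_ (depth v) → Star Adj v root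
  to-root v (acc rec) with descends v
  ... | inj₁ refl = ε
  ... | inj₂ lt   = inj₁ (refl , lt) ◅ to-root (parent v) (rec lt)

  connected : Connected graph
  connected u v =
    to-root u (<-wellFounded _) ◅◅ reverse (Graph.sym graph) (to-root v (<-wellFounded _))

  -- A path without repetitions never climbs again once it has moved from a
  -- vertex to a child, as the only way up leads back.  So a cycle through v
  -- would leave v and return to it through the same vertex, its parent.
  descend : ∀ {u x t} ws → Child x u → Unique (u ∷ x ∷ ws) → All (t ≢_) (u ∷ x ∷ ws) →
            Linked Adj (x ∷ ws ∷ʳ t) → depth x ℕ.< depth t × parent t List.∈ x ∷ ws
  descend [] (px≡u , _) _ (t≢u ∷ _) (inj₁ (px≡t , _) ∷ _) =
    contradiction (trans (sym px≡t) px≡u) t≢u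
  descend [] _ _ _ (inj₂ (pt≡x , lt) ∷ _) = lt , here pt≡x
  descend (w ∷ ws) (px≡u , _) ((_ ∷ u≢w ∷ _) ∷ _) _ (inj₁ (px≡w , _) ∷ _) =
    contradiction (trans (sym px≡u) px≡w) u≢w
  descend (w ∷ ws) _ (_ ∷ uniq) (_ ∷ t≢) (inj₂ c@(_ , lt) ∷ l)
    with lt′ , pt∈ ← descend ws c uniq t≢ l = ℕ.<-trans lt lt′ , there pt∈

  -- Either the path climbs all the way, which makes `t` shallower than `x`, or it turns downward at
  -- some vertex and `descend` applies from there.
  ascend-descend : ∀ {x w t} ws → Unique (x ∷ w ∷ ws) → All (t ≢_) (x ∷ w ∷ ws) →
                   Linked Adj (x ∷ w ∷ ws ∷ʳ t) → depth t ℕ.< depth x ⊎ parent t List.∈ w ∷ ws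
  ascend-descend ws uniq t≢ (inj₂ c ∷ l) = inj₂ (proj₂ (descend ws c uniq t≢ l))
  ascend-descend [] _ _ (inj₁ (_ , lt) ∷ inj₁ (_ , lt′) ∷ _) = inj₁ (ℕ.<-trans lt′ lt)
  ascend-descend [] _ _ (inj₁ _ ∷ inj₂ (pt≡w , _) ∷ _) = inj₂ (here pt≡w)
  ascend-descend (_ ∷ ws) (_ ∷ uniq) (_ ∷ t≢) (inj₁ (_ , lt) ∷ l) with ascend-descend ws uniq t≢ l
  ... | inj₁ lt′ = inj₁ (ℕ.<-trans lt′ lt)
  ... | inj₂ pt∈ = inj₂ (there pt∈)

  acyclic : Acyclic graph
  acyclic v (x ∷ w ∷ ws) record { distinct = v≢ ∷ uniq@(x≢ ∷ _) ; closed = inj₁ (pv≡x , lt) ∷ l }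
    with ascend-descend ws uniq v≢ l
  ... | inj₁ lt′ = ℕ.<-asym lt lt′
  ... | inj₂ pv∈ = All.lookup x≢ pv∈ (sym pv≡x)
  acyclic v (x ∷ w ∷ ws) record { distinct = (_ ∷ v≢w ∷ _) ∷ _
                                ; closed   = inj₂ (px≡v , _) ∷ inj₁ (px≡w , _) ∷ _ } =
    v≢w (trans (sym px≡v) px≡w)
  -- Two steps down force descent along the rest of the cycle, which cannot return to the shallower
  -- `v`.
  acyclic v (x ∷ w ∷ ws) record { distinct = v≢ ∷ uniq
                                ; closed   = inj₂ (_ , lt) ∷ inj₂ c@(_ , lt′) ∷ l } =
    ℕ.<-asym (ℕ.<-trans lt lt′) (proj₁ (descend ws c uniq v≢ l))
  acyclic v (_ ∷ []) record { long = s≤s () }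

  isTree : IsTree graph
  isTree = record { nonempty = nonZero root ; connected = connected ; acyclic = acyclic }
    where
    nonZero : ∀ {n} → Fin n → NonZero n
    nonZero {suc n} _ = _

-- The extremal tree.

image : ∀ {m n} (f : Fin m → Fin n) → ∃ λ S → (∀ i → f i ∈ S) × ∣ S ∣ ℕ.≤ m
image {zero}  {n} f = Subset.⊥ , (λ ()) , ℕ.≤-reflexive (∣⊥∣≡0 n)
image {suc m} f with S , f∈S , ∣S∣≤m ← image (f ∘ suc) with f zero ∈? S
... | yes f0∈S = S , (λ { zero → f0∈S ; (suc i) → f∈S i }) , ℕ.m≤n⇒m≤1+n ∣S∣≤m
... | no  f0∉S = S [ f zero ]≔ inside
  , (λ { zero → []≔-updates S (f zero) ; (suc i) → insert⊇ S (f zero) (f∈S i) })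
  , subst (ℕ._≤ suc m) (sym (∣insert∣ S (f zero) (∉⇒outside f0∉S))) (s≤s ∣S∣≤m)

module _ (k r t : ℕ) where

  -- In this order: the root, the `t` centres hanging from it, and `k` private centres for each of
  -- the `r` connectors.
  centres : ℕ
  centres = suc (t + r * k)

  Vertex : Set
  Vertex = (Fin centres ⊎ Fin r) ⊎ (Fin centres × Fin (suc k))

  vertex-index : Fin (centres + r + centres * suc k) ↔ Vertex
  vertex-index = (+↔⊎ ⊎-↔ *↔×) ↔-∘ +↔⊎

module Extremal (k r t : ℕ) {N} (index : Fin N ↔ Vertex k r t) where

  pattern centre i    = inj₁ (inj₁ i)
  pattern connector j = inj₁ (inj₂ j)
  pattern leaf i j    = inj₂ (i , j)

  open Inverse index using ()
    renaming (to to decode; from to encode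
             ; strictlyInverseˡ to decode-encode; strictlyInverseʳ to encode-decode)

  parentV : Vertex k r t → Vertex k r t
  parentV (centre zero)    = centre zero  -- a dummy: the root has no parent
  -- The first `t` non-root centres hang from the root; the others come in blocks of `k`, and
  -- `quotient k` finds the connector of a block.
  parentV (centre (suc i)) = [ const (centre zero) , connector ∘ quotient k ]′ (splitAt t i)
  parentV (connector j)    = centre zero
  parentV (leaf i j)       = centre i

  -- Only a rank decreasing towards the root, not the distance: centres hanging from the root also
  -- get 2, and its leaves get 3.
  depthV : Vertex k r t → ℕ
  depthV (centre zero)    = 0
  depthV (connector j)    = 1
  depthV (centre (suc i)) = 2
  depthV (leaf i j)       = 3

  descendsV : ∀ x → x ≡ centre zero ⊎ depthV (parentV x) ℕ.< depthV x
  descendsV (centre zero)    = inj₁ refl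
  descendsV (centre (suc i)) with splitAt t i
  ... | inj₁ _ = inj₂ (s≤s z≤n)
  ... | inj₂ _ = inj₂ (s≤s (s≤s z≤n))
  descendsV (connector j)    = inj₂ (s≤s z≤n)
  descendsV (leaf zero j)    = inj₂ (s≤s z≤n)
  descendsV (leaf (suc i) j) = inj₂ (s≤s (s≤s (s≤s z≤n)))

  parentV≢leaf : ∀ x {i j} → parentV x ≢ leaf i j
  parentV≢leaf (centre (suc i)) eq with splitAt t i
  parentV≢leaf (centre (suc i)) () | inj₁ _
  parentV≢leaf (centre (suc i)) () | inj₂ _
  parentV≢leaf (centre zero) ()
  parentV≢leaf (connector j) ()
  parentV≢leaf (leaf i j) ()

  encode-injective : ∀ {x y} → encode x ≡ encode y → x ≡ y
  encode-injective = Injection.injective (↔⇒↣ (↔-sym index))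

  descends : ∀ v → v ≡ encode (centre zero) ⊎
                   depthV (decode (encode (parentV (decode v)))) ℕ.< depthV (decode v)
  descends v with descendsV (decode v)
  ... | inj₁ eq = inj₁ (trans (sym (encode-decode v)) (cong encode eq))
  ... | inj₂ lt = inj₂ (subst (λ x → depthV x ℕ.< depthV (decode v)) (sym (decode-encode _)) lt)

  open RootedTree (encode ∘ parentV ∘ decode) (depthV ∘ decode) (encode (centre zero)) descends
    public using (isTree) renaming (graph to tree)

  open Graph tree using (Adj)

  adj-parent : ∀ x → x ≢ centre zero → Adj (encode x) (encode (parentV x))
  adj-parent x x≢ with descendsV x
  ... | inj₁ x≡ = contradiction x≡ x≢
  ... | inj₂ lt = inj₁ (cong (encode ∘ parentV) (decode-encode x)
                       , subst₂ (λ y z → depthV y ℕ.< depthV z)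
                           (sym (decode-encode (parentV x))) (sym (decode-encode x)) lt)

  leaf-neighbour : ∀ {i j u} → Adj (encode (leaf i j)) u → u ≡ encode (centre i)
  leaf-neighbour {i} {j} (inj₁ (eq , _)) =
    trans (sym eq) (cong (encode ∘ parentV) (decode-encode (leaf i j)))
  leaf-neighbour {u = u} (inj₂ (eq , _)) =
    contradiction (encode-injective eq) (parentV≢leaf (decode u))

  γ≤centres : γ tree ℕ.≤ centres k r t
  γ≤centres = ℕ.≤-trans
    (proj₂ (proj₂ (γ-minimum tree)) S λ v →
      subst (λ v → v ∉ S → ∃ λ u → u ∈ S × Adj v u) (encode-decode v) (dominated (decode v)))
    (proj₂ (proj₂ (image (encode ∘ centre′))))
    where
    centre′ : Fin (centres k r t) → Vertex k r t
    centre′ i = centre i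
    S : Subset N
    S = proj₁ (image (encode ∘ centre′))
    c∈S : ∀ i → encode (centre i) ∈ S
    c∈S = proj₁ (proj₂ (image (encode ∘ centre′)))
    dominated : ∀ x → encode x ∉ S → ∃ λ u → u ∈ S × Adj (encode x) u
    dominated (centre i)    c∉S = contradiction (c∈S i) c∉S
    dominated (connector j) _   = _ , c∈S zero , adj-parent (connector j) λ ()
    dominated (leaf i j)    _   = _ , c∈S i , adj-parent (leaf i j) λ ()

  module _ (S : Subset N) (quasi : IsQuasiperfect k tree S) where
    private
      dom = proj₁ quasi
      perfect = proj₂ quasi

    -- If `v` were outside `S`, its `k + 1` distinct neighbours `f i` would all lie in `S`, against
    -- quasiperfection. Their membership may itself be derived from `v ∉ S`, as it is for leaves.
    forced : ∀ {v} (f : Fin (suc k) → Fin N) → (∀ {i j} → f i ≡ f j → i ≡ j) →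
             (∀ i → Adj v (f i)) → (v ∉ S → ∀ i → f i ∈ S) → v ∈ S
    forced {v} f f-inj v~f f∈S with v ∈? S
    ... | yes v∈S = v∈S
    ... | no  v∉S = contradiction (perfect v v∉S) (ℕ.<⇒≱ (injective⇒≤∣S∣ f f-inj
                      (λ i → x∈p∩q⁺ (∈-neighbours⁺ tree (v~f i) , f∈S v∉S i))))

    -- A leaf outside `S` can only be dominated by its centre, so a missing centre would put all its
    -- `k + 1` leaves into `S`.
    centre∈S : ∀ i → encode (centre i) ∈ S
    centre∈S i = forced (λ j → encode (leaf i j))
      -- The value `zero` is a mere default for vertices other than leaves.
      (λ eq → cong (λ { (leaf _ j) → j ; _ → zero }) (encode-injective eq))
      (λ j → Graph.sym tree (adj-parent (leaf i j) λ ())) leaf∈S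
      where
      leaf∈S : encode (centre i) ∉ S → ∀ j → encode (leaf i j) ∈ S
      leaf∈S c∉S j with encode (leaf i j) ∈? S
      ... | yes l∈S = l∈S
      ... | no  l∉S with u , u∈S , l~u ← dom _ l∉S =
        contradiction (subst (_∈ S) (leaf-neighbour l~u) u∈S) c∉S

    -- The `k + 1` neighbours used are the root and the `k` private centres, all in `S` already.
    connector∈S : ∀ j → encode (connector j) ∈ S
    connector∈S j = forced (encode ∘ centre′) (centre′-injective ∘ encode-injective)
      adjacent (λ { _ zero → centre∈S zero ; _ (suc i) → centre∈S _ })
      where
      branch : Fin k → Fin (t + r * k)
      branch i = t ↑ʳ combine j i
      centre′ : Fin (suc k) → Vertex k r t
      centre′ zero    = centre zero
      centre′ (suc i) = centre (suc (branch i))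
      centre′-injective : ∀ {a b} → centre′ a ≡ centre′ b → a ≡ b
      centre′-injective {zero}  {zero}  _  = refl
      centre′-injective {suc a} {suc b} eq =
        cong suc (combine-injectiveʳ j a j b (↑ʳ-injective t _ _ (un eq)))
        where
        un : ∀ {a b} → _≡_ {A = Vertex k r t} (centre (suc a)) (centre (suc b)) → a ≡ b
        un refl = refl
      parent-branch : ∀ i → parentV (centre (suc (branch i))) ≡ connector j
      parent-branch i rewrite splitAt-↑ʳ t (r * k) (combine j i) =
        cong (connector ∘ proj₁) (remQuot-combine j i)
      adjacent : ∀ a → Adj (encode (connector j)) (encode (centre′ a))
      adjacent zero    = adj-parent (connector j) λ ()
      adjacent (suc i) = Graph.sym tree
        (subst (λ x → Adj (encode (centre′ (suc i))) (encode x)) (parent-branch i)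
          (adj-parent (centre′ (suc i)) λ ()))

    centres+r≤∣S∣ : centres k r t + r ℕ.≤ ∣ S ∣
    centres+r≤∣S∣ = injective⇒≤∣S∣ (encode ∘ inj₁ ∘ splitAt (centres k r t))
      (splitAt-injective ∘ inj₁-injective ∘ encode-injective) (inner ∘ splitAt (centres k r t))
      where
      splitAt-injective : ∀ {i j} → splitAt (centres k r t) i ≡ splitAt (centres k r t) j → i ≡ j
      splitAt-injective = Injection.injective (↔⇒↣ +↔⊎)
      inner : ∀ x → encode (inj₁ x) ∈ S
      inner (inj₁ i) = centre∈S i
      inner (inj₂ j) = connector∈S j

  centres+r≤γ₁ : centres k r t + r ℕ.≤ γ₁ k tree
  centres+r≤γ₁ with (S , quasi , ∣S∣≡γ₁) , _ ← proj₂ (γ₁-minimum k tree) =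
    subst (centres k r t + r ℕ.≤_) ∣S∣≡γ₁ (centres+r≤∣S∣ S quasi)

-- Arithmetic of the bound and conclusion.

quotient-bound : ∀ k .{{_ : NonZero k}} {r m} → k * r ℕ.< suc m → r ℕ.≤ m / k
quotient-bound k {r} {m} (s≤s kr≤m) = begin
  r          ≡⟨ ℕ.m*n/n≡m r k ⟨
  r * k / k  ≤⟨ ℕ./-monoˡ-≤ k (subst (ℕ._≤ m) (ℕ.*-comm k r) kr≤m) ⟩
  m / k      ∎
  where open ℕ.≤-Reasoning

≤bound : ∀ k .{{_ : NonZero k}} {c c₁} → (∃ λ r → c₁ ℕ.≤ r + c × k * r ℕ.< c) → + c₁ ≤ bound k c
-- The strict inequality `k * r < c` leaves only successors for `c`, so `bound-suc` applies.
≤bound k {suc m} {c₁} (r , c₁≤ , kr<) = subst (+ c₁ ≤_) (sym (bound-suc k m)) $ +≤+ $ begin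
  c₁              ≤⟨ c₁≤ ⟩
  r + suc m       ≤⟨ ℕ.+-monoˡ-≤ (suc m) (quotient-bound k kr<) ⟩
  m / k + suc m   ≡⟨ ℕ.+-comm (m / k) (suc m) ⟩
  suc m + m / k   ∎
  where open ℕ.≤-Reasoning

bound-attained : ∀ k .{{_ : NonZero k}} m {c c₁} → c ℕ.≤ suc m → suc m + m / k ℕ.≤ c₁ →
                 (∃ λ r → c₁ ℕ.≤ r + c × k * r ℕ.< c) → c ≡ suc m × + c₁ ≡ bound k c
bound-attained k m {c} {c₁} c≤1+m ≤c₁ upper@(r , c₁≤ , kr<c) = c≡1+m , ℤ.≤-antisym
  (≤bound k upper)
  (subst (_≤ + c₁) (sym (trans (cong (bound k) c≡1+m) (bound-suc k m))) (+≤+ ≤c₁))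
  where
  open ℕ.≤-Reasoning
  c≡1+m : c ≡ suc m
  -- Since `c ≤ suc m`, the upper estimate has `r ≤ m / k`; were `c` smaller than `suc m`, it would
  -- fall below the assumed lower bound on `c₁`.
  c≡1+m = ℕ.≤-antisym c≤1+m $ ℕ.+-cancelʳ-≤ (m / k) (suc m) c $ begin
    suc m + m / k   ≤⟨ ≤c₁ ⟩
    c₁              ≤⟨ c₁≤ ⟩
    r + c           ≤⟨ ℕ.+-monoˡ-≤ c (quotient-bound k (ℕ.<-≤-trans kr<c c≤1+m)) ⟩
    m / k + c       ≡⟨ ℕ.+-comm (m / k) c ⟩
    c + m / k       ∎

γ₁≤bound : ∀ {n} (T : Graph n) → IsTree T → ∀ k .{{_ : NonZero k}} → + γ₁ k T ≤ bound k (γ T)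
γ₁≤bound T tree k = ≤bound k {γ T} {γ₁ k T} (γ₁≤γ+r T tree k)

-- Here `m` is one less than the prescribed domination number: its quotient by `k` counts the
-- connectors, its remainder the centres hanging from the root.
extremal-tree : ∀ k .{{_ : NonZero k}} m {n} → Fin n ↔ Vertex k (m / k) (m % k) →
                ∃ λ (T : Graph n) → IsTree T × γ T ≡ suc m × + γ₁ k T ≡ bound k (γ T)
extremal-tree k m index = tree , isTree ,
  bound-attained k m {γ tree} {γ₁ k tree}
    (subst (γ tree ℕ.≤_) centres≡1+m γ≤centres)
    (subst (λ g → g + m / k ℕ.≤ γ₁ k tree) centres≡1+m centres+r≤γ₁)
    (γ₁≤γ+r tree isTree k)
  where
  open Extremal k (m / k) (m % k) index
  centres≡1+m : centres k (m / k) (m % k) ≡ suc m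
  centres≡1+m = cong suc (sym (ℕ.m≡m%n+[m/n]*n m k))

theorem2 : (∀ {n} (T : Graph n) → IsTree T → ∀ k .{{_ : NonZero k}} →
    + γ₁ k T ≤ bound k (γ T))
    ×
    (∀ k .{{_ : NonZero k}} g .{{_ : NonZero g}} →
    ∃ λ n → ∃ λ (T : Graph n) →
    IsTree T × γ T ≡ g × + γ₁ k T ≡ bound k (γ T))
theorem2 = γ₁≤bound , λ { k (suc m) → _ , extremal-tree k m (vertex-index k (m / k) (m % k)) }
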